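{- Let $L$ be a finite lattice with at least two elements. There exists $m \in \mathbf{N}$ such that for all $n \geq m$, $L$ has the $[n]$-density property.
   Context: $[n]$ is the $n$-element chain. For posets $P$ and $Q$, $Q^P$ is the set of order-preserving maps from $P$ to $Q$. For $a \in L$, $[a) = \{u \in L \mid u \geq a\}$. An element $a$ is join-irreducible iff $a = v \vee w$ implies $a = v$ or $a = w$. Let $P$ be a finite poset and $p$ the number of filters (up-closed subsets, including the empty one) of $P$; for $P=[n]$, $p = n+1$. $L$ has the $P$-density property iff there is a join-irreducible $a \in L$ with $\frac{|[a)^P|}{|L^P|} \leq \frac{1}{p}$. -}

module Defs where

open import Data.Bool using (Bool; T)
open import Data.Fin using (Fin)
open import Data.Fin.Properties using () renaming (≤-poset to Fin-≤-poset)
open import Data.Integer using (+_)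
open import Data.Nat using (ℕ; NonZero)
open import Data.Product using (Σ; Σ-syntax; ∃-syntax; _×_; proj₁)
open import Data.Rational.Unnormalised using (_/_; _≤_)
open import Data.Sum using (_⊎_)
open import Function.Bundles using (Inverse)
open import Level using (Level; _⊔_; 0ℓ)
open import Relation.Binary.Bundles using (Setoid; Poset)
import Relation.Binary.Construct.On as On
open import Relation.Binary.Lattice.Bundles using (Lattice)
open import Relation.Binary.Morphism.Bundles using (PosetHomomorphism)
open import Relation.Binary.PropositionalEquality using (_≡_; refl; sym; trans; setoid)

private
  variable
    c ℓ₁ ℓ₂ c′ ℓ₁′ ℓ₂′ : Level

HasCardinality : Setoid c ℓ₁ → ℕ → Set (c ⊔ ℓ₁)
HasCardinality S k = Inverse S (setoid (Fin k))

[_] : ℕ → Poset 0ℓ 0ℓ 0ℓ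
[ n ] = Fin-≤-poset n

infixr 8 _^_

-- Only the underlying set of Q ^ P is needed; maps are compared pointwise.
_^_ : Poset c ℓ₁ ℓ₂ → Poset c′ ℓ₁′ ℓ₂′ →
      Setoid (c ⊔ ℓ₁ ⊔ ℓ₂ ⊔ c′ ⊔ ℓ₁′ ⊔ ℓ₂′) (ℓ₁ ⊔ c′)
Q ^ P = record
  { Carrier       = PosetHomomorphism P Q
  ; _≈_           = λ f g → ∀ x → ⟦ f ⟧ x Q.≈ ⟦ g ⟧ x
  ; isEquivalence = record
    { refl  = λ _ → Q.Eq.refl
    ; sym   = λ f≈g x → Q.Eq.sym (f≈g x)
    ; trans = λ f≈g g≈h x → Q.Eq.trans (f≈g x) (g≈h x)
    }
  }
  where
  module Q = Poset Q
  open PosetHomomorphism using (⟦_⟧)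

-- Subsets are given by Boolean characteristic functions, so that a finite
-- poset has finitely many of them constructively. Compatibility with the
-- equality of P follows from up-closure.
record Filter (P : Poset c ℓ₁ ℓ₂) : Set (c ⊔ ℓ₂) where
  private module P = Poset P
  field
    member   : P.Carrier → Bool
    upClosed : ∀ {x y} → x P.≤ y → T (member x) → T (member y)

filters : Poset c ℓ₁ ℓ₂ → Setoid (c ⊔ ℓ₂) c
filters P = record
  { Carrier       = Filter P
  ; _≈_           = λ F G → ∀ x → member F x ≡ member G x
  ; isEquivalence = record
    { refl  = λ _ → refl
    ; sym   = λ F≈G x → sym (F≈G x)
    ; trans = λ F≈G G≈H x → trans (F≈G x) (G≈H x)
    }
  }
  where open Filter

module _ (L : Lattice c ℓ₁ ℓ₂) where
  private module L = Lattice L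

  -- With this definition the least element of L is join-irreducible.
  JoinIrreducible : L.Carrier → Set (c ⊔ ℓ₁)
  JoinIrreducible a = ∀ v w → a L.≈ (v L.∨ w) → (a L.≈ v) ⊎ (a L.≈ w)

  [_⟩ : L.Carrier → Poset (c ⊔ ℓ₂) ℓ₁ ℓ₂
  [ a ⟩ = On.poset {B = Σ[ u ∈ L.Carrier ] a L.≤ u} L.poset proj₁

  -- k = |[a)^P|, l = |L^P|, and p is the number of filters of P.
  HasDensityProperty : Poset c′ ℓ₁′ ℓ₂′ → Set (c ⊔ ℓ₁ ⊔ ℓ₂ ⊔ c′ ⊔ ℓ₁′ ⊔ ℓ₂′)
  HasDensityProperty P =
    Σ[ a ∈ L.Carrier ] JoinIrreducible a ×
    (∃[ k ] ∃[ l ] ∃[ p ]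
      HasCardinality ([ a ⟩ ^ P) k ×
      HasCardinality (L.poset ^ P) l ×
      HasCardinality (filters P) p ×
      Σ[ l≢0 ∈ NonZero l ] Σ[ p≢0 ∈ NonZero p ]
        (((+ k) / l) {{l≢0}} ≤ ((+ 1) / p) {{p≢0}}))

{-# OPTIONS --safe #-}
module Submission where

-- Write |x|ₙ for the number of multichains of length n above x, so that
-- |[a)^[n]| = |a|ₙ and |L^[n]| = |⊥|ₙ; we look for a join-irreducible a with
-- (n + 1)|a|ₙ ≤ |⊥|ₙ. Let q be the number of nonzero join-irreducibles.
--
-- If some m lies above all join-irreducibles except exactly one, b, then
-- x = b ∨ (x ∧ m) for all x ≥ b. So replacing an initial segment of a multichain
-- above b by its meets with m loses no information, and a = b works for every n.
--
-- Otherwise, every x ≠ ⊤ fails to lie above at least two join-irreducibles, so one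
-- less than the number of those (and 0 for ⊤) still strictly decreases along chains:
-- chains in L have length at most q − 1, and |⊥|ₙ grows like a polynomial of degree
-- at most q − 1, that is n(|⊥|ₙ₊₁ − |⊥|ₙ) ≤ (q − 1)|⊥|ₙ₊₁. On the other hand,
-- |⊥|ₙ₊₁ − |⊥|ₙ = Σ_{y > ⊥} |y|ₙ ≥ q |a|ₙ for the join-irreducible a minimising |a|ₙ
-- (which may depend on n). Together these give the claim for n ≥ q².

open import Defs
open import Algebra.Core using (Op₂)
open import Data.Bool using (Bool; true; false; if_then_else_; T)
open import Data.Bool.Properties using (T-≡)
open import Data.Fin as Fin using (Fin; zero; suc; toℕ)
open import Data.Fin.Induction using (po-wellFounded)
open import Data.Fin.Properties using (_≟_; any?; all?)
import Data.Integer as ℤ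
import Data.Integer.Properties as ℤ
open import Data.List as List using (List; []; _∷_; length; map; concat; filter; allFin)
open import Data.List.Membership.Propositional using (_∈_)
open import Data.List.Membership.Propositional.Properties
  using (∈-allFin; ∈-filter⁺; ∈-concat⁺; ∈-concat⁻; ∈-map⁺; ∈-map⁻; ∈-lookup)
open import Data.List.Properties using (length-++; length-map)
import Data.List.Relation.Unary.All as All
import Data.List.Relation.Unary.All.Properties as All
open import Data.List.Relation.Unary.AllPairs using ([]; _∷_)
import Data.List.Relation.Unary.AllPairs.Properties as AllPairs
open import Data.List.Relation.Unary.Any using (here; index)
import Data.List.Relation.Unary.Any.Properties as Any
open import Data.List.Relation.Unary.Unique.Propositional using (Unique)
import Data.List.Relation.Unary.Unique.Propositional.Properties as Unique
open import Data.Nat using (ℕ; NonZero; zero; suc; pred; _+_; _*_; _≤_; _<_; _<ᵇ_; z≤n; s≤s; >-nonZero)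
open import Data.Nat.Properties hiding (_≟_)
open import Data.Nat.Tactic.RingSolver using (solve-∀)
open import Data.Product using (∃-syntax; _×_; _,_; proj₁; proj₂)
open import Data.Rational.Unnormalised as ℚ using (_/_)
open import Data.Sum using (_⊎_; inj₁; inj₂; [_,_]′)
open import Data.Vec using (Vec; []; _∷_; head; lookup; tabulate)
open import Data.Vec.Properties using (∷-injectiveʳ; lookup∘tabulate; tabulate∘lookup; tabulate-cong)
open import Function using (_∘_)
open import Function.Bundles using (Equivalence; Inverse)
open import Induction.WellFounded using (Acc; acc)
open import Level using (Level)
open import Relation.Binary.Bundles using (Setoid; Poset)
open import Relation.Binary.Core using (Rel)
open import Relation.Binary.Lattice.Bundles using (Lattice)
import Relation.Binary.Lattice.Properties.JoinSemilattice as JoinSemilattice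
open import Relation.Binary.Lattice.Structures using (IsLattice)
open import Relation.Binary.Morphism.Bundles using (PosetHomomorphism; mkPosetHomo)
open import Relation.Binary.PropositionalEquality
  using (_≡_; _≢_; refl; sym; trans; cong; cong₂; subst; subst₂; isEquivalence; module ≡-Reasoning)
open import Relation.Nullary using (Dec; does; yes; no; ¬_; contradiction)
open import Relation.Nullary.Decidable using (map′; _×-dec_; _⊎-dec_; _→-dec_; ¬?; decidable-stable)

open import Data.List.Extrema ≤-totalOrder using (argmin; argmin-all; f[argmin]≤f[xs])
open import Algebra.Properties.Semiring.Sum +-*-semiring
  using (sum; ∑-distrib-+; ∑-comm; sum-cong-≗; sum-replicate-zero; *-distribˡ-sum; sum-syntax)

private
  variable
    ℓ ℓ₁ ℓ₂ ℓ₃ : Level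
    n : ℕ
    P : Set ℓ₁
    Q : Set ℓ₂
    R : Set ℓ₃

-- Finite sums and indicators of decidable propositions.

∑-mono : {f g : Fin n → ℕ} → (∀ i → f i ≤ g i) → sum f ≤ sum g
∑-mono {zero}  f≤g = z≤n
∑-mono {suc n} f≤g = +-mono-≤ (f≤g zero) (∑-mono (f≤g ∘ suc))

𝟙 : Dec P → ℕ
𝟙 P? = if does P? then 1 else 0

𝟙-true : (P? : Dec P) → P → 𝟙 P? ≡ 1
𝟙-true (yes _) _ = refl
𝟙-true (no ¬p) p = contradiction p ¬p

𝟙-guard : (P? : Dec P) {k l : ℕ} → (P → k ≤ l) → 𝟙 P? * k ≤ 𝟙 P? * l
𝟙-guard (yes p) k≤l = +-monoˡ-≤ 0 (k≤l p)
𝟙-guard (no _)  _   = z≤n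

𝟙-mono : (P? : Dec P) (Q? : Dec Q) → (P → Q) → 𝟙 P? ≤ 𝟙 Q?
𝟙-mono (no _)  _       _   = z≤n
𝟙-mono (yes p) (yes _) _   = ≤-refl
𝟙-mono (yes p) (no ¬q) p→q = contradiction (p→q p) ¬q

𝟙-disjoint : (P? : Dec P) (Q? : Dec Q) (R? : Dec R) →
             (P → R) → (Q → R) → (P → ¬ Q) → 𝟙 P? + 𝟙 Q? ≤ 𝟙 R?
𝟙-disjoint (no _)  Q?      R? _   q→r _    = 𝟙-mono Q? R? q→r
𝟙-disjoint (yes p) (no _)  R? p→r _   _    = ≤-reflexive (sym (𝟙-true R? (p→r p)))
𝟙-disjoint (yes p) (yes q) _  _   _   p→¬q = contradiction q (p→¬q p)

𝟙-cover : (P? : Dec P) (Q? : Dec Q) (R? : Dec R) → (R → P ⊎ Q) → 𝟙 R? ≤ 𝟙 P? + 𝟙 Q?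
𝟙-cover _       _       (no _)  _    = z≤n
𝟙-cover (yes _) _       (yes _) _    = s≤s z≤n
𝟙-cover (no _)  (yes _) (yes _) _    = ≤-refl
𝟙-cover (no ¬p) (no ¬q) (yes r) r→pq = contradiction (r→pq r) [ ¬p , ¬q ]′

∑-δ : (i : Fin n) (f : Fin n → ℕ) → ∑[ j < n ] (𝟙 (i ≟ j) * f j) ≡ f i
∑-δ {suc n} zero    f =
  trans (cong₂ _+_ (*-identityˡ (f zero)) (sum-replicate-zero n)) (+-identityʳ (f zero))
∑-δ         (suc i) f = ∑-δ i (f ∘ suc)

∑-δ-1 : (i : Fin n) → ∑[ j < n ] 𝟙 (i ≟ j) ≡ 1
∑-δ-1 i = trans (sum-cong-≗ (λ j → sym (*-identityʳ (𝟙 (i ≟ j))))) (∑-δ i (λ _ → 1))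

∑-guard-+ : ∀ (c f g : Fin n → ℕ) →
            ∑[ i < n ] (c i * (f i + g i)) ≡ ∑[ i < n ] (c i * f i) + ∑[ i < n ] (c i * g i)
∑-guard-+ c f g = trans (sum-cong-≗ (λ i → *-distribˡ-+ (c i) (f i) (g i)))
                        (∑-distrib-+ (λ i → c i * f i) (λ i → c i * g i))

∑-+-guard : ∀ (c d f : Fin n → ℕ) →
            ∑[ i < n ] ((c i + d i) * f i) ≡ ∑[ i < n ] (c i * f i) + ∑[ i < n ] (d i * f i)
∑-+-guard c d f = trans (sum-cong-≗ (λ i → *-distribʳ-+ (f i) (c i) (d i)))
                        (∑-distrib-+ (λ i → c i * f i) (λ i → d i * f i))

∑-guard-* : ∀ k (c f : Fin n → ℕ) →
            k * ∑[ i < n ] (c i * f i) ≡ ∑[ i < n ] (c i * (k * f i))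
∑-guard-* k c f = trans (*-distribˡ-sum k (λ i → c i * f i)) (sum-cong-≗ (λ i → swap k (c i) (f i)))
  where
  swap : ∀ a b c → a * (b * c) ≡ b * (a * c)
  swap = solve-∀

-- With the left inverse `ψ`, `φ` is injective on `P`, so the left terms are distinct terms of the
-- right sum. Both sides become double sums, supported on `j = φ i` and on `i = ψ j`; the first
-- support lies in the second wherever `P i` holds.
∑-injection : {P : Fin n → Set ℓ₁} {Q : Fin n → Set ℓ₂}
              (P? : ∀ i → Dec (P i)) (Q? : ∀ i → Dec (Q i)) (φ ψ : Fin n → Fin n) (f : Fin n → ℕ) →
              (∀ {i} → P i → Q (φ i)) → (∀ {i} → P i → ψ (φ i) ≡ i) →
              ∑[ i < n ] (𝟙 (P? i) * f (φ i)) ≤ ∑[ j < n ] (𝟙 (Q? j) * f j)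
∑-injection {n} P? Q? φ ψ f P⇒Q ψφ≡id = begin
  ∑[ i < n ] (𝟙 (P? i) * f (φ i))
    ≡⟨ sum-cong-≗ (λ i → ∑-δ (φ i) (λ j → 𝟙 (P? i) * f j)) ⟨
  ∑[ i < n ] ∑[ j < n ] (𝟙 (φ i ≟ j) * (𝟙 (P? i) * f j))
    ≤⟨ ∑-mono (λ i → ∑-mono (pointwise i)) ⟩
  ∑[ i < n ] ∑[ j < n ] (𝟙 (ψ j ≟ i) * (𝟙 (Q? j) * f j))
    ≡⟨ ∑-comm (λ i j → 𝟙 (ψ j ≟ i) * (𝟙 (Q? j) * f j)) ⟩
  ∑[ j < n ] ∑[ i < n ] (𝟙 (ψ j ≟ i) * (𝟙 (Q? j) * f j))
    ≡⟨ sum-cong-≗ (λ j → ∑-δ (ψ j) (λ _ → 𝟙 (Q? j) * f j)) ⟩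
  ∑[ j < n ] (𝟙 (Q? j) * f j) ∎
  where
  open ≤-Reasoning
  pointwise : ∀ i j → 𝟙 (φ i ≟ j) * (𝟙 (P? i) * f j) ≤ 𝟙 (ψ j ≟ i) * (𝟙 (Q? j) * f j)
  pointwise i j with φ i ≟ j | P? i
  ... | no _     | _     = z≤n
  ... | yes _    | no _  = z≤n
  ... | yes refl | yes p = ≤-reflexive (sym (cong₂ (λ a b → a * (b * f j))
                             (𝟙-true (ψ j ≟ i) (ψφ≡id p)) (𝟙-true (Q? j) (P⇒Q p))))

-- The density ratio by cross-multiplication.

ratio-≤ : ∀ k n {l} .{{_ : NonZero l}} → suc n * k ≤ l → (ℤ.+ k) / l ℚ.≤ (ℤ.+ 1) / suc n
ratio-≤ k n {suc l} [1+n]k≤l = ℚ.*≤* (begin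
  ℤ.+ k ℤ.* ℤ.+ suc n     ≡⟨ ℤ.pos-* k (suc n) ⟨
  ℤ.+ (k * suc n)         ≤⟨ ℤ.+≤+ (≤-trans (≤-reflexive (*-comm k (suc n))) [1+n]k≤l) ⟩
  ℤ.+ suc l               ≡⟨ ℤ.*-identityˡ (ℤ.+ suc l) ⟨
  ℤ.+ 1 ℤ.* ℤ.+ suc l     ∎)
  where open ℤ.≤-Reasoning

-- Cardinalities from duplicate-free lists.

guard : {A : Set ℓ} → Dec P → List A → List A
guard P? xs = if does P? then xs else []

module _ {A : Set ℓ} where

  length-guard : (P? : Dec P) (xs : List A) → length (guard P? xs) ≡ 𝟙 P? * length xs
  length-guard (yes _) xs = sym (*-identityˡ (length xs))
  length-guard (no _)  xs = refl

  ∈-guard⁺ : (P? : Dec P) → P → ∀ {x} {xs : List A} → x ∈ xs → x ∈ guard P? xs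
  ∈-guard⁺ (yes _) _ x∈xs = x∈xs
  ∈-guard⁺ (no ¬p) p _    = contradiction p ¬p

  ∈-guard⁻ : (P? : Dec P) {x : A} {xs : List A} → x ∈ guard P? xs → P × x ∈ xs
  ∈-guard⁻ (yes p) x∈xs = p , x∈xs

  guard-unique : (P? : Dec P) {xs : List A} → Unique xs → Unique (guard P? xs)
  guard-unique (yes _) xs! = xs!
  guard-unique (no _)  _   = []

  length-concat-tabulate : (f : Fin n → List A) →
                           length (concat (List.tabulate f)) ≡ ∑[ i < n ] length (f i)
  length-concat-tabulate {zero}  f = refl
  length-concat-tabulate {suc n} f = trans (length-++ (f zero))
    (cong (length (f zero) +_) (length-concat-tabulate (f ∘ suc)))

  unique⇒lookup-injective : {xs : List A} → Unique xs →
                            ∀ {i j} → List.lookup xs i ≡ List.lookup xs j → i ≡ j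
  unique⇒lookup-injective (_  ∷ _)   {zero}  {zero}  _  = refl
  unique⇒lookup-injective (x∉ ∷ _)   {zero}  {suc j} eq = contradiction eq (All.lookup x∉ (∈-lookup j))
  unique⇒lookup-injective (x∉ ∷ _)   {suc i} {zero}  eq = contradiction (sym eq) (All.lookup x∉ (∈-lookup i))
  unique⇒lookup-injective (_  ∷ xs!) {suc i} {suc j} eq = cong suc (unique⇒lookup-injective xs! eq)

  -- The bijection sends `s` to the position of its code in `xs`, which is unique as `xs` has no
  -- duplicates. Codes translate the equality of `S` into propositional equality.
  enumeration⇒cardinality : (S : Setoid ℓ₁ ℓ₂) (let open Setoid S) {xs : List A} → Unique xs →
    (code : Carrier → A) → (∀ {s t} → s ≈ t → code s ≡ code t) → (∀ {s t} → code s ≡ code t → s ≈ t) →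
    (∀ s → code s ∈ xs) → (∀ {x} → x ∈ xs → ∃[ s ] code s ≡ x) → HasCardinality S (length xs)
  enumeration⇒cardinality S {xs} xs! code code-cong code-injective code∈ decode = record
    { to        = to
    ; from      = from
    ; to-cong   = λ {s} {t} s≈t → unique⇒lookup-injective xs!
                    (trans (lookup-to s) (trans (code-cong s≈t) (sym (lookup-to t))))
    ; from-cong = λ { refl → refl≈ }
    ; inverse   = (λ {i} {s} s≈ → unique⇒lookup-injective xs!
                     (trans (lookup-to s) (trans (code-cong s≈) (code-from i))))
                , (λ { {s} refl → code-injective (trans (code-from (to s)) (lookup-to s)) })
    }
    where
    open Setoid S using (Carrier) renaming (refl to refl≈)
    to : Carrier → Fin (length xs)
    to s = index (code∈ s)
    from : Fin (length xs) → Carrier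
    from i = proj₁ (decode (∈-lookup i))
    lookup-to : ∀ s → List.lookup xs (to s) ≡ code s
    lookup-to s = sym (Any.lookup-index (code∈ s))
    code-from : ∀ i → code (from i) ≡ List.lookup xs i
    code-from i = proj₂ (decode (∈-lookup i))

-- Filters of a chain.

firstTrue : (Fin n → Bool) → Fin (suc n)
firstTrue {zero}  g = zero
firstTrue {suc n} g = if g zero then zero else suc (firstTrue (g ∘ suc))

firstTrue-cong : {g h : Fin n → Bool} → (∀ i → g i ≡ h i) → firstTrue g ≡ firstTrue h
firstTrue-cong {zero}  g≗h = refl
firstTrue-cong {suc n} g≗h =
  cong₂ (λ b i → if b then zero else suc i) (g≗h zero) (firstTrue-cong (g≗h ∘ suc))

-- toℕ k <ᵇ suc (toℕ i) rather than toℕ k ≤ᵇ toℕ i, as it reduces when both k and i are successors.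
firstTrue-≤ : (k : Fin (suc n)) → firstTrue (λ (i : Fin n) → toℕ k <ᵇ suc (toℕ i)) ≡ k
firstTrue-≤ {zero}  zero    = refl
firstTrue-≤ {suc n} zero    = refl
firstTrue-≤ {suc n} (suc k) = cong suc (firstTrue-≤ k)

-- If `g zero` is true, up-closure makes `g` true everywhere; otherwise the tail of `g` is again
-- up-closed.
≤-firstTrue : (g : Fin n → Bool) → (∀ {i j} → i Fin.≤ j → T (g i) → T (g j)) →
              ∀ i → (toℕ (firstTrue g) <ᵇ suc (toℕ i)) ≡ g i
≤-firstTrue {suc n} g up i with g zero in g₀
≤-firstTrue {suc n} g up i       | true  = sym (Equivalence.to T-≡ (up z≤n (subst T (sym g₀) _)))
≤-firstTrue {suc n} g up zero    | false = sym g₀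
≤-firstTrue {suc n} g up (suc i) | false = ≤-firstTrue (g ∘ suc) (up ∘ s≤s) i

-- A filter of a chain is determined by its least element; the value `n`, one past the last index,
-- encodes the empty filter.
filters-cardinality : ∀ n → HasCardinality (filters [ n ]) (suc n)
filters-cardinality n = record
  { to        = λ F → firstTrue (member F)
  ; from      = from
  ; to-cong   = firstTrue-cong
  ; from-cong = λ { refl i → refl }
  ; inverse   = (λ {k} F≈ → trans (firstTrue-cong F≈) (firstTrue-≤ k))
              , (λ { {F} refl → ≤-firstTrue (member F) (upClosed F) })
  }
  where
  open Filter
  from : Fin (suc n) → Filter [ n ]
  from k = record
    { member   = λ i → toℕ k <ᵇ suc (toℕ i)
    ; upClosed = λ i≤j k≤i → <⇒<ᵇ (≤-trans (<ᵇ⇒< (toℕ k) _ k≤i) (s≤s i≤j))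
    }

-- Arithmetic combining the two bounds on the growth.

growth⇒sparse : ∀ q {n A D M} → 2 ≤ q → q * q ≤ n →
                n * D ≤ pred q * (M + D) → q * A ≤ D → suc n * A ≤ M
growth⇒sparse (suc h@(suc _)) {n} {A} {D} {M} (s≤s (s≤s z≤n)) q²≤n nD≤ qA≤D
  -- Here `h = q - 1` and `n = h + k`. Cancelling `h * D` in the growth bound leaves
  -- `k * D ≤ h * M`, while `q * q ≤ n` makes `k` at least `h * h + h`, which absorbs the part of
  -- `h * (n + 1)` without a factor `k`.
  with k , refl ← m≤n⇒∃[o]m+o≡n (≤-trans (m≤n*m h (suc h)) (≤-trans (*-monoʳ-≤ (suc h) (n≤1+n h)) q²≤n))
  = *-cancelˡ-≤ h (begin
    h * (suc (h + k) * A)          ≡⟨ expandˡ h k A ⟩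
    (h * h + h) * A + h * k * A    ≤⟨ +-monoˡ-≤ (h * k * A) (*-monoˡ-≤ A h²+h≤k) ⟩
    k * A + h * k * A              ≡⟨ collect h k A ⟩
    k * (suc h * A)                ≤⟨ *-monoʳ-≤ k qA≤D ⟩
    k * D                          ≤⟨ +-cancelʳ-≤ (h * D) (k * D) (h * M) kD+hD≤ ⟩
    h * M                          ∎)
  where
  open ≤-Reasoning
  expandˡ : ∀ h k A → h * (suc (h + k) * A) ≡ (h * h + h) * A + h * k * A
  expandˡ = solve-∀
  collect : ∀ h k A → k * A + h * k * A ≡ k * (suc h * A)
  collect = solve-∀
  square : ∀ h → suc h * suc h ≡ h + suc (h * h + h)
  square = solve-∀
  sum-of-products : ∀ h k D → k * D + h * D ≡ (h + k) * D
  sum-of-products = solve-∀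
  h²+h≤k : h * h + h ≤ k
  h²+h≤k = ≤-trans (n≤1+n _) (+-cancelˡ-≤ h _ _ (≤-trans (≤-reflexive (sym (square h))) q²≤n))
  kD+hD≤ : k * D + h * D ≤ h * M + h * D
  kD+hD≤ = begin
    k * D + h * D     ≡⟨ sum-of-products h k D ⟩
    (h + k) * D       ≤⟨ nD≤ ⟩
    h * (M + D)       ≡⟨ *-distribˡ-+ h M D ⟩
    h * M + h * D     ∎

-- The bound on `l` excludes `k = 0`, `l = 1`, where both predecessors are 0.
pred-mono-<-≥2 : ∀ {k l} → k < l → 2 ≤ l → pred k < pred l
pred-mono-<-≥2 {zero}  _         (s≤s 1≤l) = 1≤l
pred-mono-<-≥2 {suc k} (s≤s k<l) _         = k<l

-- Counting multichains in a finite lattice.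

module MultichainCount {N} {_⊑_ : Rel (Fin N) ℓ} {_∨_ _∧_ : Op₂ (Fin N)}
                       (isLattice : IsLattice _≡_ _⊑_ _∨_ _∧_) where

  open IsLattice isLattice
    using (x≤x∨y; y≤x∨y; ∨-least; x∧y≤x; x∧y≤y; ∧-greatest; isPartialOrder)
    renaming (refl to ⊑-refl; reflexive to ⊑-reflexive; trans to ⊑-trans; antisym to ⊑-antisym)

  infix 4 _⊑?_ _⊏_ _⊏?_

  _⊑?_ : ∀ x y → Dec (x ⊑ y)
  x ⊑? y = map′ (λ x∧y≡x → subst (_⊑ y) x∧y≡x (x∧y≤y x y))
                (λ x⊑y → ⊑-antisym (x∧y≤x x y) (∧-greatest ⊑-refl x⊑y))
                (x ∧ y ≟ x)

  _⊏_ : Rel (Fin N) ℓ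
  x ⊏ y = x ⊑ y × x ≢ y

  _⊏?_ : ∀ x y → Dec (x ⊏ y)
  x ⊏? y = x ⊑? y ×-dec ¬? (x ≟ y)

  -- |x|ₙ in the notation above.
  count : Fin N → ℕ → ℕ
  count x zero    = 1
  count x (suc n) = ∑[ y < N ] (𝟙 (x ⊑? y) * count y n)

  -- By `count-suc`, this is the forward difference of `count x` at `n`.
  countAbove : Fin N → ℕ → ℕ
  countAbove x n = ∑[ y < N ] (𝟙 (x ⊏? y) * count y n)

  -- A multichain whose first entry is `x` continues as any multichain of length `n` above `x`; all
  -- others start strictly above `x`.
  count-suc : ∀ x n → count x (suc n) ≡ count x n + countAbove x n
  count-suc x n = begin
    ∑[ y < N ] (𝟙 (x ⊑? y) * count y n)
      ≡⟨ sum-cong-≗ (λ y → cong (_* count y n) (split y)) ⟩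
    ∑[ y < N ] ((𝟙 (x ≟ y) + 𝟙 (x ⊏? y)) * count y n)
      ≡⟨ ∑-+-guard (λ y → 𝟙 (x ≟ y)) (λ y → 𝟙 (x ⊏? y)) (λ y → count y n) ⟩
    ∑[ y < N ] (𝟙 (x ≟ y) * count y n) + countAbove x n
      ≡⟨ cong (_+ countAbove x n) (∑-δ x (λ y → count y n)) ⟩
    count x n + countAbove x n ∎
    where
    open ≡-Reasoning
    ⊑⇒≡⊎⊏ : ∀ {y} → x ⊑ y → x ≡ y ⊎ x ⊏ y
    ⊑⇒≡⊎⊏ {y} x⊑y with x ≟ y
    ... | yes x≡y = inj₁ x≡y
    ... | no  x≢y = inj₂ (x⊑y , x≢y)
    split : ∀ y → 𝟙 (x ⊑? y) ≡ 𝟙 (x ≟ y) + 𝟙 (x ⊏? y)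
    split y = ≤-antisym
      (𝟙-cover (x ≟ y) (x ⊏? y) (x ⊑? y) ⊑⇒≡⊎⊏)
      (𝟙-disjoint (x ≟ y) (x ⊏? y) (x ⊑? y) ⊑-reflexive proj₁ (λ x≡y x⊏y → proj₂ x⊏y x≡y))

  count>0 : ∀ x n → 0 < count x n
  count>0 x zero    = ≤-refl
  count>0 x (suc n) = begin-strict
    0                          <⟨ count>0 x n ⟩
    count x n                  ≤⟨ m≤m+n _ _ ⟩
    count x n + countAbove x n ≡⟨ count-suc x n ⟨
    count x (suc n)            ∎
    where open ≤-Reasoning

  count-antitone : ∀ {x y} → x ⊑ y → ∀ n → count y n ≤ count x n
  count-antitone         x⊑y zero    = ≤-refl
  count-antitone {x} {y} x⊑y (suc n) = ∑-mono λ z →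
    *-monoˡ-≤ (count z n) (𝟙-mono (y ⊑? z) (x ⊑? z) (⊑-trans x⊑y))

  -- If r x bounds the length of the chains going up from x, then count x has
  -- degree at most r x in n, and n · countAbove is bounded by its "derivative".
  count-growth : (r : Fin N → ℕ) → (∀ {x y} → x ⊏ y → r y < r x) →
                 ∀ n x → n * countAbove x n ≤ r x * count x (suc n)
  count-growth r r-anti zero    x = z≤n
  count-growth r r-anti (suc n) x = begin
    -- One copy of `A′` is grouped with `n * B` and bounded by the induction hypothesis at each `y`
    -- strictly above `x`; the rest, `n * A`, is bounded by the induction hypothesis at `x`.
    suc n * A′                           ≡⟨ cong (λ c → A′ + n * c) A′≡A+B ⟩
    A′ + n * (A + B)                     ≡⟨ rearrange A′ n A B ⟩
    (A′ + n * B) + n * A                 ≤⟨ +-mono-≤ A′+nB≤ (count-growth r r-anti n x) ⟩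
    r x * A′ + r x * count x (suc n)     ≡⟨ *-distribˡ-+ (r x) A′ _ ⟨
    r x * (A′ + count x (suc n))         ≡⟨ cong (r x *_) (trans (+-comm A′ _) (sym (count-suc x (suc n)))) ⟩
    r x * count x (suc (suc n))          ∎
    where
    open ≤-Reasoning
    rearrange : ∀ a n b c → a + n * (b + c) ≡ (a + n * c) + n * b
    rearrange = solve-∀
    𝟙ₓ : Fin N → ℕ
    𝟙ₓ y = 𝟙 (x ⊏? y)
    A A′ B : ℕ
    A  = countAbove x n
    A′ = countAbove x (suc n)
    B  = ∑[ y < N ] (𝟙 (x ⊏? y) * countAbove y n)
    A′≡A+B : A′ ≡ A + B
    A′≡A+B = trans (sum-cong-≗ (λ y → cong (𝟙 (x ⊏? y) *_) (count-suc y n)))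
                   (∑-guard-+ 𝟙ₓ (λ y → count y n) (λ y → countAbove y n))
    -- The strict drop from `r x` to `r y` absorbs the extra `count y (suc n)`.
    step : ∀ {y} → x ⊏ y → count y (suc n) + n * countAbove y n ≤ r x * count y (suc n)
    step {y} x⊏y = begin
      count y (suc n) + n * countAbove y n      ≤⟨ +-monoʳ-≤ (count y (suc n)) (count-growth r r-anti n y) ⟩
      suc (r y) * count y (suc n)               ≤⟨ *-monoˡ-≤ (count y (suc n)) (r-anti x⊏y) ⟩
      r x * count y (suc n)                     ∎
    A′+nB≤ : A′ + n * B ≤ r x * A′
    A′+nB≤ = begin
      A′ + n * B
        ≡⟨ cong (A′ +_) (∑-guard-* n 𝟙ₓ (λ y → countAbove y n)) ⟩
      A′ + ∑[ y < N ] (𝟙 (x ⊏? y) * (n * countAbove y n))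
        ≡⟨ ∑-guard-+ 𝟙ₓ (λ y → count y (suc n)) (λ y → n * countAbove y n) ⟨
      ∑[ y < N ] (𝟙 (x ⊏? y) * (count y (suc n) + n * countAbove y n))
        ≤⟨ ∑-mono (λ y → 𝟙-guard (x ⊏? y) step) ⟩
      ∑[ y < N ] (𝟙 (x ⊏? y) * (r x * count y (suc n)))
        ≡⟨ ∑-guard-* (r x) 𝟙ₓ (λ y → count y (suc n)) ⟨
      r x * A′ ∎

  -- The factor `suc n` counts the lengths 0 to `n` of the initial segment met with `m`. Replaced
  -- entries are exactly those not above `b`, so the segment can be read off, and joining with `b`
  -- restores them.
  count-pivot : ∀ {b m} → ¬ b ⊑ m → (∀ {x} → b ⊑ x → x ⊑ (b ∨ (x ∧ m))) →
                ∀ n {x} → b ⊑ x → suc n * count x n ≤ count (x ∧ m) n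
  count-pivot         b⋢m recover zero        b⊑x = ≤-refl
  count-pivot {b} {m} b⋢m recover (suc n) {x} b⊑x = begin
    count x (suc n) + suc n * count x (suc n)
      -- The copy of `count x (suc n)` set apart stands for the multichains with no entry replaced.
      -- In the others the first entry `y` becomes `y ∧ m`, and the induction hypothesis handles the
      -- tail.
      ≡⟨ cong (count x (suc n) +_) (∑-guard-* (suc n) (λ y → 𝟙 (x ⊑? y)) (λ y → count y n)) ⟩
    count x (suc n) + ∑[ y < N ] (𝟙 (x ⊑? y) * (suc n * count y n))
      ≤⟨ +-monoʳ-≤ (count x (suc n)) (∑-mono λ y → 𝟙-guard (x ⊑? y)
           (λ x⊑y → count-pivot b⋢m recover n (⊑-trans b⊑x x⊑y))) ⟩
    count x (suc n) + ∑[ y < N ] (𝟙 (x ⊑? y) * count (y ∧ m) n)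
      ≤⟨ +-monoʳ-≤ (count x (suc n)) (∑-injection (x ⊑?_) missing? (_∧ m) (b ∨_) (λ z → count z n)
           meets-missing (λ x⊑y → recover-≡ (⊑-trans b⊑x x⊑y))) ⟩
    count x (suc n) + ∑[ z < N ] (𝟙 (missing? z) * count z n)
      ≡⟨ ∑-+-guard (λ z → 𝟙 (x ⊑? z)) (λ z → 𝟙 (missing? z)) (λ z → count z n) ⟨
    ∑[ z < N ] ((𝟙 (x ⊑? z) + 𝟙 (missing? z)) * count z n)
      ≤⟨ ∑-mono (λ z → *-monoˡ-≤ (count z n) (𝟙-disjoint (x ⊑? z) (missing? z) (x ∧ m ⊑? z)
           (⊑-trans (x∧y≤x x m)) proj₁ (λ x⊑z → λ (_ , b⋢z) → b⋢z (⊑-trans b⊑x x⊑z)))) ⟩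
    count (x ∧ m) (suc n) ∎
    where
    open ≤-Reasoning
    missing? : ∀ z → Dec ((x ∧ m) ⊑ z × ¬ b ⊑ z)
    missing? z = x ∧ m ⊑? z ×-dec ¬? (b ⊑? z)
    meets-missing : ∀ {y} → x ⊑ y → (x ∧ m) ⊑ (y ∧ m) × ¬ b ⊑ (y ∧ m)
    meets-missing x⊑y = ∧-greatest (⊑-trans (x∧y≤x _ _) x⊑y) (x∧y≤y _ _)
                      , λ b⊑ → b⋢m (⊑-trans b⊑ (x∧y≤y _ _))
    recover-≡ : ∀ {y} → b ⊑ y → b ∨ (y ∧ m) ≡ y
    recover-≡ b⊑y = ⊑-antisym (∨-least b⊑y (x∧y≤x _ _)) (recover b⊑y)

  -- Multichains as order-preserving maps from a chain.

  infixr 5 _∷_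

  -- Each tail is bounded below by the entry before it, which matches the recursion of `count`.
  data Multichain (x : Fin N) : Vec (Fin N) n → Set ℓ where
    []  : Multichain x []
    _∷_ : ∀ {y} {ys : Vec (Fin N) n} → x ⊑ y → Multichain y ys → Multichain x (y ∷ ys)

  multichain-tabulate : ∀ {x} (g : Fin n → Fin N) → (∀ i → x ⊑ g i) →
                        (∀ {i j} → i Fin.≤ j → g i ⊑ g j) → Multichain x (tabulate g)
  multichain-tabulate {zero}  g x⊑g g-mono = []
  multichain-tabulate {suc n} g x⊑g g-mono =
    x⊑g zero ∷ multichain-tabulate (g ∘ suc) (λ i → g-mono z≤n) (g-mono ∘ s≤s)

  multichain-lower : ∀ {x} {v : Vec (Fin N) n} → Multichain x v → ∀ i → x ⊑ lookup v i
  multichain-lower (x⊑y ∷ ys) zero    = x⊑y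
  multichain-lower (x⊑y ∷ ys) (suc i) = ⊑-trans x⊑y (multichain-lower ys i)

  multichain-mono : ∀ {x} {v : Vec (Fin N) n} → Multichain x v →
                    ∀ {i j} → i Fin.≤ j → lookup v i ⊑ lookup v j
  multichain-mono (x⊑y ∷ ys) {zero}  {zero}  _         = ⊑-refl
  multichain-mono (x⊑y ∷ ys) {zero}  {suc j} _         = multichain-lower ys j
  multichain-mono (x⊑y ∷ ys) {suc i} {suc j} (s≤s i≤j) = multichain-mono ys i≤j

  multichains : Fin N → ∀ n → List (Vec (Fin N) n)
  multichains x zero    = [] ∷ []
  multichains x (suc n) = concat (List.tabulate λ y → guard (x ⊑? y) (map (y ∷_) (multichains y n)))

  length-multichains : ∀ x n → length (multichains x n) ≡ count x n
  length-multichains x zero    = refl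
  length-multichains x (suc n) = trans
    (length-concat-tabulate (λ y → guard (x ⊑? y) (map (y ∷_) (multichains y n))))
    (sum-cong-≗ λ y → trans (length-guard (x ⊑? y) _)
      (cong (𝟙 (x ⊑? y) *_) (trans (length-map (y ∷_) (multichains y n)) (length-multichains y n))))

  multichain⇒∈ : ∀ {x} {v : Vec (Fin N) n} → Multichain x v → v ∈ multichains x n
  multichain⇒∈         []                   = here refl
  multichain⇒∈ {x = x} (_∷_ {y = y} x⊑y ys) = ∈-concat⁺
    (Any.tabulate⁺ y (∈-guard⁺ (x ⊑? y) x⊑y (∈-map⁺ (y ∷_) (multichain⇒∈ ys))))

  ∈⇒multichain : ∀ {x} {v : Vec (Fin N) n} → v ∈ multichains x n → Multichain x v
  ∈⇒multichain {zero}          (here refl) = []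
  ∈⇒multichain {suc n} {x} v∈
    with y , v∈block ← Any.tabulate⁻ {f = λ y → guard (x ⊑? y) (map (y ∷_) (multichains y n))}
                                     (∈-concat⁻ (List.tabulate _) v∈)
    with x⊑y , v∈map ← ∈-guard⁻ (x ⊑? y) v∈block
    with _ , ys∈ , refl ← ∈-map⁻ (y ∷_) v∈map
    = x⊑y ∷ ∈⇒multichain ys∈

  multichains-unique : ∀ x n → Unique (multichains x n)
  multichains-unique x zero    = All.[] ∷ []
  multichains-unique x (suc n) = Unique.concat⁺
    (All.tabulate⁺ λ y → guard-unique (x ⊑? y)
      (Unique.map⁺ ∷-injectiveʳ (multichains-unique y n)))
    -- Blocks for different first entries are disjoint, since a vector determines its head.
    (AllPairs.tabulate⁺ λ y≢z (v∈y , v∈z) → y≢z (trans (sym (head≡ v∈y)) (head≡ v∈z)))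
    where
    head≡ : ∀ {y} {v : Vec (Fin N) (suc n)} →
            v ∈ guard (x ⊑? y) (map (y ∷_) (multichains y n)) → head v ≡ y
    head≡ {y} v∈ with _ , _ , refl ← ∈-map⁻ (y ∷_) (proj₂ (∈-guard⁻ (x ⊑? y) v∈)) = refl

  module _ {q ℓ₁ ℓ₂} (Q : Poset q ℓ₁ ℓ₂) where

    private module Q = Poset Q

    module _ (x : Fin N) (e : Q.Carrier → Fin N)
             (e-mono : ∀ {u v} → u Q.≤ v → e u ⊑ e v) (e-reflect : ∀ {u v} → e u ⊑ e v → u Q.≤ v)
             (e-lower : ∀ u → x ⊑ e u) (e-onto : ∀ {y} → x ⊑ y → ∃[ u ] e u ≡ y) where

      -- Up to the equality of `Q`, `e` is an order isomorphism onto the elements above `x`, so the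
      -- vector of values of a map is a multichain above `x`. It serves both for `[a)` and, with `x`
      -- least, for the whole lattice.
      homs-cardinality : ∀ n → HasCardinality (Q ^ [ n ]) (count x n)
      homs-cardinality n = subst (HasCardinality (Q ^ [ n ])) (length-multichains x n)
        (enumeration⇒cardinality (Q ^ [ n ]) (multichains-unique x n) code
          (λ f≈g → tabulate-cong λ i → ⊑-antisym (e-mono (Q.reflexive (f≈g i)))
                                                  (e-mono (Q.reflexive (Q.Eq.sym (f≈g i)))))
          (λ {f} {g} code≡ i → let eᵢ≡ = code-injective f g code≡ i in
            Q.antisym (e-reflect (⊑-reflexive eᵢ≡)) (e-reflect (⊑-reflexive (sym eᵢ≡))))
          (λ f → multichain⇒∈ (multichain-tabulate (e ∘ ⟦ f ⟧) (e-lower ∘ ⟦ f ⟧) (e-mono ∘ mono f)))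
          (decode ∘ ∈⇒multichain))
        where
        open PosetHomomorphism using (⟦_⟧; mono)
        code : PosetHomomorphism [ n ] Q → Vec (Fin N) n
        code f = tabulate (e ∘ ⟦ f ⟧)
        code-injective : ∀ f g → code f ≡ code g → ∀ i → e (⟦ f ⟧ i) ≡ e (⟦ g ⟧ i)
        code-injective f g code≡ i = trans (sym (lookup∘tabulate (e ∘ ⟦ f ⟧) i))
          (trans (cong (λ v → lookup v i) code≡) (lookup∘tabulate (e ∘ ⟦ g ⟧) i))
        decode : ∀ {v} → Multichain x v → ∃[ f ] code f ≡ v
        decode {v} xv =
            mkPosetHomo [ n ] Q (proj₁ ∘ preimage) (λ i≤j → e-reflect
              (subst₂ _⊑_ (sym (proj₂ (preimage _))) (sym (proj₂ (preimage _))) (multichain-mono xv i≤j)))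
          , trans (tabulate-cong (proj₂ ∘ preimage)) (tabulate∘lookup v)
          where
          preimage : ∀ i → ∃[ u ] e u ≡ lookup v i
          preimage i = e-onto (multichain-lower xv i)

  -- Join-irreducibles and pivots.

  JI : Fin N → Set
  JI j = ∀ v w → j ≡ v ∨ w → j ≡ v ⊎ j ≡ w

  JI? : ∀ j → Dec (JI j)
  JI? j = all? λ v → all? λ w → (j ≟ v ∨ w) →-dec (j ≟ v ⊎-dec j ≟ w)

  -- Descend from `x` to a minimal element not below `z`. It is join-irreducible: two strictly
  -- smaller elements would both lie below `z`, and so would their join.
  JI-separates : ∀ {x z} → ¬ x ⊑ z → ∃[ j ] JI j × j ⊑ x × ¬ j ⊑ z
  JI-separates {x} {z} = go x (po-wellFounded isPartialOrder x)
    where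
    go : ∀ x → Acc _⊏_ x → ¬ x ⊑ z → ∃[ j ] JI j × j ⊑ x × ¬ j ⊑ z
    go x (acc rec) x⋢z with any? (λ y → y ⊏? x ×-dec ¬? (y ⊑? z))
    ... | yes (y , y⊏x , y⋢z) =
      let j , j-JI , j⊑y , j⋢z = go y (rec y⊏x) y⋢z in j , j-JI , ⊑-trans j⊑y (proj₁ y⊏x) , j⋢z
    ... | no minimal = x , x-JI , ⊑-refl , x⋢z
      where
      below : ∀ {y} → y ⊑ x → x ≢ y → y ⊑ z
      below {y} y⊑x x≢y = decidable-stable (y ⊑? z) λ y⋢z → minimal (y , (y⊑x , x≢y ∘ sym) , y⋢z)
      x-JI : JI x
      x-JI v w x≡v∨w with x ≟ v | x ≟ w
      ... | yes x≡v | _       = inj₁ x≡v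
      ... | no _    | yes x≡w = inj₂ x≡w
      ... | no x≢v  | no x≢w  = contradiction
        (subst (_⊑ z) (sym x≡v∨w) (∨-least
          (below (subst (v ⊑_) (sym x≡v∨w) (x≤x∨y v w)) x≢v)
          (below (subst (w ⊑_) (sym x≡v∨w) (y≤x∨y v w)) x≢w)))
        x⋢z

  JI-⋢? : ∀ x j → Dec (JI j × ¬ j ⊑ x)
  JI-⋢? x j = JI? j ×-dec ¬? (j ⊑? x)

  Pivot : Fin N → Fin N → Set ℓ
  Pivot b m = (JI b × ¬ b ⊑ m) × (∀ j → JI j × ¬ j ⊑ m → j ≡ b)

  pivot? : ∀ b m → Dec (Pivot b m)
  pivot? b m = JI-⋢? m b ×-dec all? λ j → JI-⋢? m j →-dec (j ≟ b)

  -- Otherwise some join-irreducible below `x` is not below `b ∨ (x ∧ m)`. It cannot lie below `m`,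
  -- so it is `b`, which does lie below that join.
  pivot-recover : ∀ {b m} → Pivot b m → ∀ {x} → b ⊑ x → x ⊑ (b ∨ (x ∧ m))
  pivot-recover {b} {m} (_ , unique) {x} b⊑x =
    decidable-stable (x ⊑? b ∨ (x ∧ m)) λ x⋢ →
      let j , j-JI , j⊑x , j⋢ = JI-separates x⋢
          j⋢m = λ j⊑m → j⋢ (⊑-trans (∧-greatest j⊑x j⊑m) (y≤x∨y b (x ∧ m)))
      in j⋢ (subst (_⊑ (b ∨ (x ∧ m))) (sym (unique j (j-JI , j⋢m))) (x≤x∨y b (x ∧ m)))

  -- The least element satisfies `JI` but lies below every `x`, so it is never counted; at the least
  -- element the value is the number q of nonzero join-irreducibles.
  corank : Fin N → ℕ
  corank x = ∑[ j < N ] 𝟙 (JI-⋢? x j)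

  -- Going up to `y` gains a join-irreducible `j₀` that is below `y` but not below `x`, and loses
  -- none.
  corank-antitone : ∀ {x y} → x ⊏ y → corank y < corank x
  corank-antitone {x} {y} (x⊑y , x≢y) = begin
    1 + corank y
      ≡⟨ cong (_+ corank y) (∑-δ-1 j₀) ⟨
    ∑[ j < N ] 𝟙 (j₀ ≟ j) + corank y
      ≡⟨ ∑-distrib-+ (λ j → 𝟙 (j₀ ≟ j)) (λ j → 𝟙 (JI-⋢? y j)) ⟨
    ∑[ j < N ] (𝟙 (j₀ ≟ j) + 𝟙 (JI-⋢? y j))
      ≤⟨ ∑-mono (λ j → 𝟙-disjoint (j₀ ≟ j) (JI-⋢? y j) (JI-⋢? x j)
           (λ { refl → j₀-JI , j₀⋢x }) (λ (j-JI , j⋢y) → j-JI , λ j⊑x → j⋢y (⊑-trans j⊑x x⊑y))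
           (λ { refl (_ , j⋢y) → j⋢y j₀⊑y })) ⟩
    corank x ∎
    where
    open ≤-Reasoning
    sep = JI-separates (λ y⊑x → x≢y (⊑-antisym x⊑y y⊑x))
    j₀ = proj₁ sep
    j₀-JI = proj₁ (proj₂ sep)
    j₀⊑y = proj₁ (proj₂ (proj₂ sep))
    j₀⋢x = proj₂ (proj₂ (proj₂ sep))

  -- Some join-irreducible `j₀` is not below `x`; if it were the only one, `j₀` and `x` would form a
  -- pivot.
  corank≥2 : ¬ (∃[ b ] ∃[ m ] Pivot b m) → ∀ {x y} → x ⊏ y → 2 ≤ corank x
  corank≥2 no-pivot {x} {y} (x⊑y , x≢y) with JI-separates (λ y⊑x → x≢y (⊑-antisym x⊑y y⊑x))
  ... | j₀ , j₀-JI , _ , j₀⋢x with any? (λ j → JI-⋢? x j ×-dec ¬? (j ≟ j₀))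
  ... | no none = contradiction
    (j₀ , x , (j₀-JI , j₀⋢x) , λ j j-ok → decidable-stable (j ≟ j₀) λ j≢j₀ → none (j , j-ok , j≢j₀))
    no-pivot
  ... | yes (j₁ , j₁-ok , j₁≢j₀) = begin
    2 ≡⟨ cong₂ _+_ (∑-δ-1 j₀) (∑-δ-1 j₁) ⟨
    ∑[ j < N ] 𝟙 (j₀ ≟ j) + ∑[ j < N ] 𝟙 (j₁ ≟ j)
      ≡⟨ ∑-distrib-+ (λ j → 𝟙 (j₀ ≟ j)) (λ j → 𝟙 (j₁ ≟ j)) ⟨
    ∑[ j < N ] (𝟙 (j₀ ≟ j) + 𝟙 (j₁ ≟ j))
      ≤⟨ ∑-mono (λ j → 𝟙-disjoint (j₀ ≟ j) (j₁ ≟ j) (JI-⋢? x j)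
           (λ { refl → j₀-JI , j₀⋢x }) (λ { refl → j₁-ok }) (λ { refl j₁≡j₀ → j₁≢j₀ j₁≡j₀ })) ⟩
    corank x ∎
    where open ≤-Reasoning

  argmin-JI : (f : Fin N → ℕ) → ∃[ j ] JI j → ∃[ a ] JI a × (∀ j → JI j → f a ≤ f j)
  argmin-JI f (j₀ , j₀-JI) =
      -- `j₀` is the starting value of `argmin` and a candidate for the result, so it too must be
      -- join-irreducible.
      argmin f j₀ JIs
    , argmin-all f j₀-JI (All.all-filter JI? (allFin N))
    , λ j j-JI → All.lookup (f[argmin]≤f[xs] j₀ JIs) (∈-filter⁺ JI? (∈-allFin j) j-JI)
    where JIs = filter JI? (allFin N)

  -- A join-irreducible satisfying the density bound.

  module _ {⊥ : Fin N} (⊥-min : ∀ x → ⊥ ⊑ x) (nontrivial : ∃[ x ] ⊥ ≢ x) where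

    dense-JI : ∃[ n₀ ] ∀ n → n₀ ≤ n → ∃[ a ] JI a × suc n * count a n ≤ count ⊥ n
    dense-JI with any? (λ b → any? (λ m → pivot? b m))
    ... | yes (b , m , pivot@((b-JI , b⋢m) , _)) = 0 , λ n _ → b , b-JI ,
      ≤-trans (count-pivot b⋢m (pivot-recover pivot) n ⊑-refl) (count-antitone (⊥-min (b ∧ m)) n)
    ... | no no-pivot = q * q , λ n q²≤n →
      let a , a-JI , minimal = argmin-JI (λ j → count j n) (proj₁ j₀ , proj₁ (proj₂ j₀))
      in a , a-JI , growth⇒sparse q 2≤q q²≤n
           (begin
             -- The predecessor matters: with `corank` itself as the chain bound, the same argument
             -- would give only the factor `n - q` in place of `n + 1`.
             n * countAbove ⊥ n                         ≤⟨ count-growth (pred ∘ corank) pred-corank-antitone n ⊥ ⟩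
             pred q * count ⊥ (suc n)                   ≡⟨ cong (pred q *_) (count-suc ⊥ n) ⟩
             pred q * (count ⊥ n + countAbove ⊥ n)      ∎)
           (begin
             q * count a n                              ≡⟨ *-comm q (count a n) ⟩
             count a n * q                              ≡⟨ *-distribˡ-sum (count a n) (λ j → 𝟙 (JI-⋢? ⊥ j)) ⟩
             ∑[ j < N ] (count a n * 𝟙 (JI-⋢? ⊥ j))     ≡⟨ sum-cong-≗ (λ j → *-comm (count a n) (𝟙 (JI-⋢? ⊥ j))) ⟩
             ∑[ j < N ] (𝟙 (JI-⋢? ⊥ j) * count a n)     ≤⟨ ∑-mono (λ j →
               𝟙-guard (JI-⋢? ⊥ j) (λ (j-JI , _) → minimal j j-JI)) ⟩
             ∑[ j < N ] (𝟙 (JI-⋢? ⊥ j) * count j n)     ≤⟨ ∑-mono (λ j →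
               *-monoˡ-≤ (count j n) (𝟙-mono (JI-⋢? ⊥ j) (⊥ ⊏? j) JI-⋢⊥⇒⊏)) ⟩
             countAbove ⊥ n                             ∎)
      where
      open ≤-Reasoning
      q : ℕ
      q = corank ⊥
      j₀ : ∃[ j ] JI j × j ⊑ proj₁ nontrivial × ¬ j ⊑ ⊥
      j₀ = JI-separates (λ x⊑⊥ → proj₂ nontrivial (⊑-antisym (⊥-min _) x⊑⊥))
      JI-⋢⊥⇒⊏ : ∀ {j} → JI j × ¬ j ⊑ ⊥ → ⊥ ⊏ j
      JI-⋢⊥⇒⊏ {j} (_ , j⋢⊥) = ⊥-min j , λ ⊥≡j → j⋢⊥ (⊑-reflexive (sym ⊥≡j))
      2≤q : 2 ≤ q
      2≤q = corank≥2 no-pivot (⊥-min (proj₁ nontrivial) , proj₂ nontrivial)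
      pred-corank-antitone : ∀ {x y} → x ⊏ y → pred (corank y) < pred (corank x)
      pred-corank-antitone x⊏y = pred-mono-<-≥2 (corank-antitone x⊏y) (corank≥2 no-pivot x⊏y)

-- Transport to an arbitrary finite lattice.

finite-minimum : ∀ {c ℓ₁ ℓ₂} (L : Lattice c ℓ₁ ℓ₂) (let open Lattice L using (Carrier; _∧_) renaming (_≤_ to _⊑_)) →
                 Carrier → (f : Fin n → Carrier) → ∃[ z ] ∀ i → z ⊑ f i
finite-minimum {n = zero}  L x f = x , λ ()
finite-minimum {n = suc n} L x f =
  let z , z⊑f = finite-minimum L x (f ∘ suc)
  in f zero ∧ z , λ { zero → x∧y≤x _ _ ; (suc i) → ⊑-trans (x∧y≤y _ _) (z⊑f i) }
  where open Lattice L using (_∧_; x∧y≤x; x∧y≤y) renaming (trans to ⊑-trans)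

module _ {c ℓ₁ ℓ₂} (L : Lattice c ℓ₁ ℓ₂) {N : ℕ} (card : HasCardinality (Lattice.setoid L) N) where

  private
    module L = Lattice L
    open Inverse card using (to; from; to-cong; strictlyInverseˡ; strictlyInverseʳ)
    open JoinSemilattice L.joinSemilattice using (∨-cong)

  from-to-≤ : ∀ {u v} → u L.≤ v → from (to u) L.≤ from (to v)
  from-to-≤ u≤v = L.≤-respˡ-≈ (L.Eq.sym (strictlyInverseʳ _)) (L.≤-respʳ-≈ (L.Eq.sym (strictlyInverseʳ _)) u≤v)

  from-to-≤⁻ : ∀ {u v} → from (to u) L.≤ from (to v) → u L.≤ v
  from-to-≤⁻ u≤v = L.≤-respˡ-≈ (strictlyInverseʳ _) (L.≤-respʳ-≈ (strictlyInverseʳ _) u≤v)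

  -- Along the bijection the equality of `L` becomes propositional equality on `Fin N`, which is
  -- decidable and allows sums over all elements.
  transported-isLattice : IsLattice _≡_ (λ i j → from i L.≤ from j)
                            (λ i j → to (from i L.∨ from j)) (λ i j → to (from i L.∧ from j))
  transported-isLattice = record
    { isPartialOrder = record
      { isPreorder = record
        { isEquivalence = isEquivalence
        ; reflexive     = λ { refl → L.refl }
        ; trans         = L.trans
        }
      ; antisym = λ {i} {j} i≤j j≤i →
          trans (sym (strictlyInverseˡ i)) (trans (to-cong (L.antisym i≤j j≤i)) (strictlyInverseˡ j))
      }
    ; supremum = λ i j →
        L.≤-respʳ-≈ (L.Eq.sym (strictlyInverseʳ _)) (L.x≤x∨y _ _)
      , L.≤-respʳ-≈ (L.Eq.sym (strictlyInverseʳ _)) (L.y≤x∨y _ _)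
      , λ k i≤k j≤k → L.≤-respˡ-≈ (L.Eq.sym (strictlyInverseʳ _)) (L.∨-least i≤k j≤k)
    ; infimum = λ i j →
        L.≤-respˡ-≈ (L.Eq.sym (strictlyInverseʳ _)) (L.x∧y≤x _ _)
      , L.≤-respˡ-≈ (L.Eq.sym (strictlyInverseʳ _)) (L.x∧y≤y _ _)
      , λ k k≤i k≤j → L.≤-respʳ-≈ (L.Eq.sym (strictlyInverseʳ _)) (L.∧-greatest k≤i k≤j)
    }

  open MultichainCount transported-isLattice

  JI⇒JoinIrreducible : ∀ {a} → JI a → JoinIrreducible L (from a)
  JI⇒JoinIrreducible {a} a-JI v w a≈v∨w =
    [ (λ a≡v → inj₁ (from≈ a≡v)) , (λ a≡w → inj₂ (from≈ a≡w)) ]′ (a-JI (to v) (to w) a≡)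
    where
    from≈ : ∀ {u} → a ≡ to u → from a L.≈ u
    from≈ refl = strictlyInverseʳ _
    a≡ : a ≡ to (from (to v) L.∨ from (to w))
    a≡ = trans (sym (strictlyInverseˡ a)) (to-cong (L.Eq.trans a≈v∨w
      (∨-cong (L.Eq.sym (strictlyInverseʳ v)) (L.Eq.sym (strictlyInverseʳ w)))))

  upset-homs-cardinality : ∀ a n → HasCardinality ([_⟩ L (from a) ^ [ n ]) (count a n)
  upset-homs-cardinality a = homs-cardinality ([_⟩ L (from a)) a (to ∘ proj₁) from-to-≤ from-to-≤⁻
    (λ (_ , a≤u) → L.≤-respʳ-≈ (L.Eq.sym (strictlyInverseʳ _)) a≤u)
    (λ {y} a≤y → (from y , a≤y) , strictlyInverseˡ y)

  lattice-homs-cardinality : ∀ {⊥} → (∀ x → from ⊥ L.≤ from x) →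
                             ∀ n → HasCardinality (L.poset ^ [ n ]) (count ⊥ n)
  lattice-homs-cardinality {⊥} ⊥-min = homs-cardinality L.poset ⊥ to from-to-≤ from-to-≤⁻
    (⊥-min ∘ to) (λ {y} _ → from y , strictlyInverseˡ y)

  finite⇒density : ∀ {⊥} → (∀ x → from ⊥ L.≤ from x) → ∃[ x ] ⊥ ≢ x →
                   ∃[ m ] (∀ n → m ≤ n → HasDensityProperty L [ n ])
  finite⇒density {⊥} ⊥-min nontrivial =
    let m , dense = dense-JI ⊥-min nontrivial in m , λ n m≤n →
    let a , a-JI , bound = dense n m≤n in
      from a , JI⇒JoinIrreducible a-JI
    , count a n , count ⊥ n , suc n
    , upset-homs-cardinality a n , lattice-homs-cardinality ⊥-min n , filters-cardinality n
    , >-nonZero (count>0 ⊥ n) , _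
    , ratio-≤ (count a n) n {{>-nonZero (count>0 ⊥ n)}} bound

theorem4p9p1 : ∀ {c ℓ₁ ℓ₂} (L : Lattice c ℓ₁ ℓ₂) (N : ℕ) →
    HasCardinality (Lattice.setoid L) N → 2 ≤ N →
    ∃[ m ] (∀ n → m ≤ n → HasDensityProperty L [ n ])
theorem4p9p1 L (suc (suc _)) card (s≤s (s≤s z≤n)) =
  finite⇒density L card {⊥ = to ⊥} (λ x → L.≤-respˡ-≈ (L.Eq.sym (strictlyInverseʳ ⊥)) (⊥-min x)) nontrivial
  where
  module L = Lattice L
  open Inverse card using (to; from; strictlyInverseʳ)
  ⊥ : L.Carrier
  ⊥ = proj₁ (finite-minimum L (from zero) from)
  ⊥-min : ∀ x → ⊥ L.≤ from x
  ⊥-min = proj₂ (finite-minimum L (from zero) from)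
  nontrivial : ∃[ x ] to ⊥ ≢ x
  -- As `N` is at least 2, one of the indices 0 and 1 differs from that of the least element.
  nontrivial with to ⊥
  ... | zero  = suc zero , λ ()
  ... | suc _ = zero , λ ()
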